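{- Let $G$ be a finite group of order $v$ and let $n\ge 2$. If $G$ allows a regular set of (anti)automorphisms of size $n-1$, then any $(v,k,\lambda)$ difference set in $G$ extends to dimension $n$.
   Context: Groups are written additively but are not necessarily abelian. A $(v,k,\lambda)$ difference set in a group $G$ of order $v$ is a $k$-subset $D\subseteq G$ such that every $g\in G\setminus\{0\}$ can be written as $g=a-b$ with $a,b\in D$ in exactly $\lambda$ ways. An $n$-dimensional $(v,k,\lambda)$ difference set in $G$ is a $k$-subset $E\subseteq G^n$ of $n$-tuples such that for every pair of coordinates $1\le x<y\le n$ the set $\{e_x-e_y\mid e\in E\}$ is a $(v,k,\lambda)$ difference set in $G$. A $(v,k,\lambda)$ difference set $D\subseteq G$ extends to dimension $n$ if there is an $n$-dimensional $(v,k,\lambda)$ difference set $E\subseteq G^n$ and two distinct coordinates $x\ne y$ such that $D=\{e_x-e_y\mid e\in E\}$. An antiautomorphism of $G$ is a bijection $\varphi:G\to G$ such that $\varphi(g+h)=\varphi(h)+\varphi(g)$ for all $g,h\in G$. A set $R=\{\varphi_1,\ldots,\varphi_{n-1}\}$ of $n-1$ functions is a regular set of (anti)automorphisms of $G$ if each $\varphi_x:G\to G$ is an automorphism or antiautomorphism, and each difference $\varphi_x-\varphi_y$, defined by $(\varphi_x-\varphi_y)(g)=\varphi_x(g)-\varphi_y(g)$, is an automorphism or antiautomorphism for $1\le x<y\le n-1$. -}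

module Defs where

open import Level using (Level; _⊔_) renaming (suc to lsuc)
open import Algebra.Bundles using (Group)
open import Algebra.Morphism.Structures using (module GroupMorphisms)
open import Data.Fin using (Fin; _<_)
open import Data.Nat using (ℕ)
open import Data.Product using (∃; ∃-syntax; _×_; _,_; proj₁)
open import Data.Product.Relation.Binary.Pointwise.NonDependent using (×-setoid)
open import Data.Sum using (_⊎_)
open import Data.Vec.Functional using (Vector)
open import Data.Vec.Functional.Relation.Binary.Equality.Setoid using (≋-setoid)
open import Function.Bundles using (Inverse)
open import Function.Definitions using (Congruent; Bijective)
open import Relation.Binary.Bundles using (Setoid)
open import Relation.Binary.Definitions using (_Respects_)
import Relation.Binary.Construct.On as On
open import Relation.Binary.PropositionalEquality as ≡ using (_≡_; _≢_)
open import Relation.Nullary using (¬_)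
open import Relation.Unary using (Pred; _∈_; _≐_)

HasCardinality : ∀ {a ℓ} → Setoid a ℓ → ℕ → Set (a ⊔ ℓ)
HasCardinality S n = Inverse (≡.setoid (Fin n)) S

-- Elements are compared by the underlying element of S, so different
-- membership proofs are never counted separately.
subsetoid : ∀ {a ℓ p} (S : Setoid a ℓ) → Pred (Setoid.Carrier S) p → Setoid (a ⊔ p) ℓ
subsetoid S P = On.setoid S (proj₁ {B = P})

-- A subset of a setoid is a predicate that respects its equality.
record IsSubsetOfSize {a ℓ p} (S : Setoid a ℓ) (k : ℕ)
                      (P : Pred (Setoid.Carrier S) p) : Set (a ⊔ ℓ ⊔ p) where
  field
    respects    : P Respects (Setoid._≈_ S)
    cardinality : HasCardinality (subsetoid S P) k

-- The stdlib group is multiplicative; it is written additively here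
-- without assuming commutativity, and a - b is a + (- b), in this order.
module _ {c ℓ : Level} (G : Group c ℓ) where

  open Group G renaming (_∙_ to _+_; ε to 0#; _//_ to _-_) hiding (_-_)
  open GroupMorphisms rawGroup rawGroup using (IsGroupIsomorphism)

  Representations : ∀ {p} → Pred Carrier p → Carrier → Pred (Carrier × Carrier) (ℓ ⊔ p)
  Representations D g (a , b) = a ∈ D × b ∈ D × g ≈ a - b

  record IsDifferenceSet {p} (v k λ′ : ℕ) (D : Pred Carrier p) : Set (c ⊔ ℓ ⊔ p) where
    field
      order           : HasCardinality setoid v
      isSubset        : IsSubsetOfSize setoid k D
      representations : ∀ g → ¬ g ≈ 0# →
        HasCardinality (subsetoid (×-setoid setoid setoid) (Representations D g)) λ′

  Differences : ∀ {n p} → Pred (Vector Carrier n) p → Fin n → Fin n → Pred Carrier (c ⊔ ℓ ⊔ p)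
  Differences E x y g = ∃[ e ] e ∈ E × g ≈ e x - e y

  record IsMultidimensionalDifferenceSet {p} (n v k λ′ : ℕ)
           (E : Pred (Vector Carrier n) p) : Set (c ⊔ ℓ ⊔ p) where
    field
      order       : HasCardinality setoid v
      isSubset    : IsSubsetOfSize (≋-setoid setoid n) k E
      differences : ∀ x y → x < y → IsDifferenceSet v k λ′ (Differences E x y)

  ExtendsToDimension : ∀ {p} (n v k λ′ : ℕ) → Pred Carrier p → Set (lsuc (c ⊔ ℓ ⊔ p))
  ExtendsToDimension {p} n v k λ′ D =
    ∃ λ (E : Pred (Vector Carrier n) (c ⊔ ℓ ⊔ p)) →
      IsMultidimensionalDifferenceSet n v k λ′ E ×
      (∃[ x ] ∃[ y ] x ≢ y × D ≐ Differences E x y)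

  IsAutomorphism : (Carrier → Carrier) → Set (c ⊔ ℓ)
  IsAutomorphism = IsGroupIsomorphism

  record IsAntiautomorphism (φ : Carrier → Carrier) : Set (c ⊔ ℓ) where
    field
      cong      : Congruent _≈_ _≈_ φ
      bijective : Bijective _≈_ _≈_ φ
      anti-homo : ∀ g h → φ (g + h) ≈ φ h + φ g

  IsAutoOrAntiauto : (Carrier → Carrier) → Set (c ⊔ ℓ)
  IsAutoOrAntiauto φ = IsAutomorphism φ ⊎ IsAntiautomorphism φ

  -- A set of m functions is given by an enumeration without repetitions.
  -- The field distinct follows from the others unless G is trivial.
  record IsRegularSet {m : ℕ} (φ : Fin m → Carrier → Carrier) : Set (c ⊔ ℓ) where
    field
      distinct    : ∀ x y → x ≢ y → ¬ (∀ g → φ x g ≈ φ y g)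
      members     : ∀ x → IsAutoOrAntiauto (φ x)
      differences : ∀ x y → x < y → IsAutoOrAntiauto (λ g → φ x g - φ y g)

  AllowsRegularSetOfSize : ℕ → Set (c ⊔ ℓ)
  AllowsRegularSetOfSize m = ∃ λ (φ : Fin m → Carrier → Carrier) → IsRegularSet φ

{-# OPTIONS --safe #-}

-- Let N(g) and M(g) count the pairs (a, b) of D × D with a - b = g and
-- - b + a = g.  Both sum to k² over G, they agree at 0, and ∑ M² = ∑ N², as
-- - b + a = - d + c exactly when d - b = c - a.  If N is constant off 0, this
-- forces ∑ (M - N)² = 0, so M = N.  Hence images of D under automorphisms and
-- antiautomorphisms are difference sets with the same parameters, and the tuples
-- (0, φ₁ d, …, φₙ₋₁ d) with φ₁ d ∈ D form the required extension: the differences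
-- of their coordinates are such images, the one of φ₁ d and 0 being D itself.
module Submission where

open import Defs
open import Algebra.Bundles using (Group)
open import Data.Nat using (ℕ; _≤_; _∸_)
open import Relation.Unary using (Pred)

import Algebra.Properties.Group as GroupProperties
import Algebra.Properties.Semiring.Sum as SemiringSum
open import Algebra.Morphism.Structures using (module GroupMorphisms)
open import Data.Bool using (if_then_else_)
open import Data.Fin as Fin using (Fin; zero; suc)
open import Data.Fin.Permutation using (↔⇒≡)
open import Data.Fin.Properties using (_≟_; +↔⊎; suc-injective)
open import Data.Nat using (zero; suc; _+_; _*_; ∣_-_∣; s≤s)
open import Data.Nat.Properties
  using (+-*-semiring; +-comm; *-comm; *-identityʳ; *-zeroʳ; +-identityʳ; +-cancelˡ-≡; +-cancelʳ-≡;
         m+n≡0⇒m≡0; m+n≡0⇒n≡0; m*n≡0⇒m≡0∨n≡0; ∣m-n∣≡0⇒m≡n)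
open import Data.Nat.Tactic.RingSolver using (solve-∀)
open import Data.Product using (Σ; ∃-syntax; _×_; _,_; proj₁; proj₂)
open import Data.Product.Function.Dependent.Propositional using () renaming (cong to Σ-cong)
open import Data.Product.Relation.Binary.Pointwise.NonDependent using (×-setoid)
open import Data.Sum using (_⊎_; inj₁; inj₂; [_,_]′; reduce)
open import Data.Sum.Function.Propositional using (_⊎-cong_)
import Data.Vec.Functional as Vector
open import Data.Vec.Functional.Relation.Binary.Equality.Setoid using (≋-setoid)
open import Function using (_∘_; _⇔_; _↔_; mk↔ₛ′; mk⇔; Inverse; Equivalence)
open import Function.Construct.Composition using () renaming (inverse to _∙ᵢ_)
open import Function.Construct.Symmetry using () renaming (inverse to symᵢ; bijective to sym-bijective)
open import Function.Definitions using (Congruent; Injective; StrictlySurjective; Bijective)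
open import Function.Properties.Bijection using (Bijection⇒Inverse)
open import Function.Properties.Inverse using (↔-refl; ↔-trans)
open import Level using (Level; _⊔_)
open import Relation.Binary.Bundles using (Setoid)
open import Relation.Binary.Definitions using (_Respects_)
open import Relation.Binary.PropositionalEquality as ≡ using (_≡_; _≢_; refl; cong; cong₂; module ≡-Reasoning)
open import Relation.Nullary using (¬_; Dec; yes; no; does; contradiction)
open import Relation.Nullary.Decidable using (does-⇔)
import Relation.Binary.Reasoning.Setoid as SetoidReasoning
open import Relation.Unary using (_∈_)

open SemiringSum +-*-semiring
  using (sum; sum-syntax; sum-cong-≗; ∑-distrib-+; ∑-comm; *-distribˡ-sum; *-distribʳ-sum; sum-replicate-zero)

private
  variable
    a b ℓ₁ ℓ₂ p q : Level

-- Sums over finite sets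

𝟙 : {A : Set a} → Dec A → ℕ
𝟙 A? = if does A? then 1 else 0

𝟙-cong : {A : Set a} {B : Set b} → A ⇔ B → (A? : Dec A) (B? : Dec B) → 𝟙 A? ≡ 𝟙 B?
𝟙-cong A⇔B A? B? = cong (if_then 1 else 0) (does-⇔ A⇔B A? B?)

∑-𝟙-select : ∀ {n} (s : Fin n) (w : Fin n → ℕ) → ∑[ t < n ] (𝟙 (s ≟ t) * w t) ≡ w s
∑-𝟙-select {suc n} zero    w =
  ≡.trans (cong₂ _+_ (+-identityʳ (w zero)) (sum-replicate-zero n)) (+-identityʳ (w zero))
∑-𝟙-select {suc n} (suc s) w =
  ≡.trans (sum-cong-≗ λ t → cong (_* w (suc t)) (𝟙-cong (mk⇔ suc-injective (cong suc)) (suc s ≟ suc t) (s ≟ t)))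
          (∑-𝟙-select s (w ∘ suc))

∑≡0⇒≗0 : ∀ {n} (f : Fin n → ℕ) → sum f ≡ 0 → ∀ i → f i ≡ 0
∑≡0⇒≗0 f eq zero    = m+n≡0⇒m≡0 (f zero) eq
∑≡0⇒≗0 f eq (suc i) = ∑≡0⇒≗0 (f ∘ suc) (m+n≡0⇒n≡0 (f zero) eq) i

-- (m - n)² expanded, with the cross term moved so that no subtraction occurs.
m²+n²≡2mn+∣m-n∣² : ∀ m n → m * m + n * n ≡ (m * n + m * n) + ∣ m - n ∣ * ∣ m - n ∣
m²+n²≡2mn+∣m-n∣² zero    n       = refl
m²+n²≡2mn+∣m-n∣² (suc m) zero    rewrite *-zeroʳ m = +-identityʳ _
m²+n²≡2mn+∣m-n∣² (suc m) (suc n) = begin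
  suc m * suc m + suc n * suc n                              ≡⟨ lhs m n ⟩
  (m * m + n * n) + (2 + 2 * m + 2 * n)                      ≡⟨ cong (_+ (2 + 2 * m + 2 * n)) (m²+n²≡2mn+∣m-n∣² m n) ⟩
  (m * n + m * n) + δ + (2 + 2 * m + 2 * n)                  ≡⟨ rhs m n δ ⟩
  (suc m * suc n + suc m * suc n) + δ                        ∎
  where
  open ≡-Reasoning
  δ = ∣ m - n ∣ * ∣ m - n ∣
  lhs : ∀ m n → suc m * suc m + suc n * suc n ≡ (m * m + n * n) + (2 + 2 * m + 2 * n)
  lhs = solve-∀
  rhs : ∀ m n δ → (m * n + m * n) + δ + (2 + 2 * m + 2 * n) ≡ (suc m * suc n + suc m * suc n) + δ
  rhs = solve-∀

-- As `M - N` vanishes at `z` and `N` is `c` elsewhere, `∑ (M - N) N = c ∑ (M - N) = 0`. Thus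
-- `∑ M N = ∑ N²`, and with equal second moments `∑ (M - N)² = 0`. All of this is arranged without
-- subtraction, to stay in ℕ.
≗-from-moments : ∀ {n} (M N : Fin n → ℕ) (z : Fin n) (c : ℕ) →
  M z ≡ N z → (∀ t → t ≢ z → N t ≡ c) →
  sum M ≡ sum N → ∑[ t < n ] (M t * M t) ≡ ∑[ t < n ] (N t * N t) →
  ∀ t → M t ≡ N t
≗-from-moments {n} M N z c Mz≡Nz N-const ∑M≡∑N ∑M²≡∑N² t =
  ∣m-n∣≡0⇒m≡n (reduce (m*n≡0⇒m≡0∨n≡0 _ (∑≡0⇒≗0 δ ∑δ≡0 t)))
  where
  open ≡-Reasoning
  δ : Fin n → ℕ
  δ t = ∣ M t - N t ∣ * ∣ M t - N t ∣
  -- (M - N)(N - c) = 0, with the negative terms moved to the other side.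
  cross : ∀ t → M t * N t + c * N t ≡ c * M t + N t * N t
  cross t with t ≟ z
  ... | yes refl rewrite Mz≡Nz = +-comm (N t * N t) (c * N t)
  ... | no  t≢z  rewrite N-const t t≢z = cong (_+ c * c) (*-comm (M t) c)
  ∑MN≡∑N² : ∑[ t < n ] (M t * N t) ≡ ∑[ t < n ] (N t * N t)
  ∑MN≡∑N² = +-cancelʳ-≡ (c * sum N) _ _ (begin
    ∑[ t < n ] (M t * N t) + c * sum N               ≡⟨ cong (∑[ t < n ] (M t * N t) +_) (*-distribˡ-sum c N) ⟩
    ∑[ t < n ] (M t * N t) + ∑[ t < n ] (c * N t)    ≡⟨ ∑-distrib-+ (λ t → M t * N t) (λ t → c * N t) ⟨
    ∑[ t < n ] (M t * N t + c * N t)                 ≡⟨ sum-cong-≗ cross ⟩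
    ∑[ t < n ] (c * M t + N t * N t)                 ≡⟨ ∑-distrib-+ (λ t → c * M t) (λ t → N t * N t) ⟩
    ∑[ t < n ] (c * M t) + ∑[ t < n ] (N t * N t)    ≡⟨ cong (_+ ∑[ t < n ] (N t * N t)) (*-distribˡ-sum c M) ⟨
    c * sum M + ∑[ t < n ] (N t * N t)               ≡⟨ cong (λ s → c * s + ∑[ t < n ] (N t * N t)) ∑M≡∑N ⟩
    c * sum N + ∑[ t < n ] (N t * N t)               ≡⟨ +-comm (c * sum N) _ ⟩
    ∑[ t < n ] (N t * N t) + c * sum N               ∎)
  ∑2MN : ∑[ t < n ] (M t * N t + M t * N t) ≡ ∑[ t < n ] (N t * N t) + ∑[ t < n ] (N t * N t)
  ∑2MN = ≡.trans (∑-distrib-+ (λ t → M t * N t) (λ t → M t * N t)) (cong₂ _+_ ∑MN≡∑N² ∑MN≡∑N²)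
  ∑δ≡0 : sum δ ≡ 0
  ∑δ≡0 = +-cancelˡ-≡ (∑[ t < n ] (M t * N t + M t * N t)) _ _ (begin
    ∑[ t < n ] (M t * N t + M t * N t) + sum δ         ≡⟨ ∑-distrib-+ (λ t → M t * N t + M t * N t) δ ⟨
    ∑[ t < n ] ((M t * N t + M t * N t) + δ t)         ≡⟨ sum-cong-≗ (λ t → m²+n²≡2mn+∣m-n∣² (M t) (N t)) ⟨
    ∑[ t < n ] (M t * M t + N t * N t)                 ≡⟨ ∑-distrib-+ (λ t → M t * M t) (λ t → N t * N t) ⟩
    ∑[ t < n ] (M t * M t) + ∑[ t < n ] (N t * N t)    ≡⟨ cong (_+ ∑[ t < n ] (N t * N t)) ∑M²≡∑N² ⟩
    ∑[ t < n ] (N t * N t) + ∑[ t < n ] (N t * N t)    ≡⟨ ∑2MN ⟨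
    ∑[ t < n ] (M t * N t + M t * N t)                 ≡⟨ +-identityʳ _ ⟨
    ∑[ t < n ] (M t * N t + M t * N t) + 0             ∎)

-- Counting the pairs at which a function takes a given value

multiplicity : ∀ {k v} → (Fin k → Fin k → Fin v) → Fin v → ℕ
multiplicity {k} f t = ∑[ i < k ] ∑[ j < k ] 𝟙 (f i j ≟ t)

-- Moving the sum over `t` innermost leaves, for each pair, only the term `t = f i j`. Weight 1
-- yields the first moment of the multiplicity, and the multiplicity itself as weight yields the
-- second.
∑-multiplicity : ∀ {k v} (f : Fin k → Fin k → Fin v) (w : Fin v → ℕ) →
  ∑[ t < v ] (multiplicity f t * w t) ≡ ∑[ i < k ] ∑[ j < k ] w (f i j)
∑-multiplicity {k} {v} f w = begin
  ∑[ t < v ] (multiplicity f t * w t)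
    ≡⟨ sum-cong-≗ (λ t → ≡.trans (*-distribʳ-sum (w t) (λ i → ∑[ j < k ] 𝟙 (f i j ≟ t)))
                                 (sum-cong-≗ λ i → *-distribʳ-sum (w t) (λ j → 𝟙 (f i j ≟ t)))) ⟩
  ∑[ t < v ] ∑[ i < k ] ∑[ j < k ] (𝟙 (f i j ≟ t) * w t)
    ≡⟨ ∑-comm (λ t i → ∑[ j < k ] (𝟙 (f i j ≟ t) * w t)) ⟩
  ∑[ i < k ] ∑[ t < v ] ∑[ j < k ] (𝟙 (f i j ≟ t) * w t)
    ≡⟨ sum-cong-≗ (λ i → ∑-comm (λ t j → 𝟙 (f i j ≟ t) * w t)) ⟩
  ∑[ i < k ] ∑[ j < k ] ∑[ t < v ] (𝟙 (f i j ≟ t) * w t)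
    ≡⟨ sum-cong-≗ (λ i → sum-cong-≗ λ j → ∑-𝟙-select (f i j) w) ⟩
  ∑[ i < k ] ∑[ j < k ] w (f i j) ∎
  where open ≡-Reasoning

-- The second moment of `f′` counts quadruples with `f′ l m ≡ f′ i j`. The exchange hypothesis turns
-- these into coincidences of `f`, so the second moments agree and `≗-from-moments` applies.
multiplicity-unique : ∀ {k v} (f f′ : Fin k → Fin k → Fin v) (z : Fin v) (c : ℕ) →
  (∀ i j l m → f′ l m ≡ f′ i j ⇔ f j m ≡ f i l) →
  (∀ i j → f′ i j ≡ z ⇔ f i j ≡ z) →
  (∀ t → t ≢ z → multiplicity f t ≡ c) →
  ∀ t → multiplicity f′ t ≡ multiplicity f t
multiplicity-unique {k} {v} f f′ z c exchange at-z constant =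
  ≗-from-moments (multiplicity f′) (multiplicity f) z c
    (sum-cong-≗ λ i → sum-cong-≗ λ j → 𝟙-cong (at-z i j) (f′ i j ≟ z) (f i j ≟ z))
    constant
    (≡.trans (total f′) (≡.sym (total f)))
    (begin
      ∑[ t < v ] (multiplicity f′ t * multiplicity f′ t)
        ≡⟨ ∑-multiplicity f′ (multiplicity f′) ⟩
      ∑[ i < k ] ∑[ j < k ] ∑[ l < k ] ∑[ m < k ] 𝟙 (f′ l m ≟ f′ i j)
        ≡⟨ sum-cong-≗ (λ i → sum-cong-≗ λ j → sum-cong-≗ λ l → sum-cong-≗ λ m →
             𝟙-cong (exchange i j l m) (f′ l m ≟ f′ i j) (f j m ≟ f i l)) ⟩
      ∑[ i < k ] ∑[ j < k ] ∑[ l < k ] ∑[ m < k ] 𝟙 (f j m ≟ f i l)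
        -- With `l` summed before `j`, the outer pair is `(i , l)` and the inner pair `(j , m)`, so
        -- the inner double sum is `multiplicity f (f i l)`.
        ≡⟨ sum-cong-≗ (λ i → ∑-comm (λ j l → ∑[ m < k ] 𝟙 (f j m ≟ f i l))) ⟩
      ∑[ i < k ] ∑[ l < k ] ∑[ j < k ] ∑[ m < k ] 𝟙 (f j m ≟ f i l)
        ≡⟨ ∑-multiplicity f (multiplicity f) ⟨
      ∑[ t < v ] (multiplicity f t * multiplicity f t) ∎)
  where
  open ≡-Reasoning
  total : ∀ g → sum (multiplicity g) ≡ ∑[ i < k ] ∑[ j < k ] 1
  total g = ≡.trans (sum-cong-≗ λ t → ≡.sym (*-identityʳ (multiplicity g t))) (∑-multiplicity g (λ _ → 1))

-- Cardinalities of subsets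

Fin-∑↔Σ : ∀ {n} (f : Fin n → ℕ) → Fin (sum f) ↔ Σ (Fin n) (Fin ∘ f)
Fin-∑↔Σ {zero}  f = mk↔ₛ′ (λ ()) (λ ()) (λ ()) (λ ())
Fin-∑↔Σ {suc n} f = ↔-trans +↔⊎ (↔-trans (↔-refl ⊎-cong Fin-∑↔Σ (f ∘ suc))
  (mk↔ₛ′ [ (zero ,_) , (λ (i , x) → suc i , x) ]′
         (λ { (zero , x) → inj₁ x ; (suc i , x) → inj₂ (i , x) })
         (λ { (zero , x) → refl ; (suc i , x) → refl })
         (λ { (inj₁ x) → refl ; (inj₂ (i , x)) → refl })))

bijective⇒inverse : (S : Setoid a ℓ₁) (T : Setoid b ℓ₂)
  (f : Setoid.Carrier S → Setoid.Carrier T) →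
  Congruent (Setoid._≈_ S) (Setoid._≈_ T) f →
  Injective (Setoid._≈_ S) (Setoid._≈_ T) f →
  StrictlySurjective (Setoid._≈_ T) f →
  Inverse S T
bijective⇒inverse S T f f-cong f-inj f-surj = Bijection⇒Inverse (record
  { to        = f
  ; cong      = f-cong
  ; bijective = f-inj , λ y → proj₁ (f-surj y) , λ x≈ → Setoid.trans T (f-cong x≈) (proj₂ (f-surj y))
  })

subsetoid-inverse : (S : Setoid a ℓ₁) (T : Setoid b ℓ₂)
  (P : Pred (Setoid.Carrier S) p) (Q : Pred (Setoid.Carrier T) q)
  (f : Setoid.Carrier S → Setoid.Carrier T) →
  Congruent (Setoid._≈_ S) (Setoid._≈_ T) f →
  Injective (Setoid._≈_ S) (Setoid._≈_ T) f →
  (∀ {x} → x ∈ P → f x ∈ Q) →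
  (∀ {y} → y ∈ Q → ∃[ x ] x ∈ P × Setoid._≈_ T (f x) y) →
  Inverse (subsetoid S P) (subsetoid T Q)
subsetoid-inverse S T P Q f f-cong f-inj P⇒Q Q⇒P =
  bijective⇒inverse (subsetoid S P) (subsetoid T Q) (λ (x , x∈P) → f x , P⇒Q x∈P) f-cong f-inj
    (λ (y , y∈Q) → let x , x∈P , fx≈y = Q⇒P y∈Q in (x , x∈P) , fx≈y)

Fin² : ℕ → Setoid _ _
Fin² k = ×-setoid (≡.setoid (Fin k)) (≡.setoid (Fin k))

-- A pair contributes `Fin (𝟙 (P? i j))`, which has one element if `P` holds and none otherwise.
-- These marks stand in for proofs of `P`, which need not be unique.
Fin²-cardinality : ∀ {k} (P : Pred (Fin k × Fin k) p) (P? : ∀ i j → Dec (P (i , j))) →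
  HasCardinality (subsetoid (Fin² k) P) (∑[ i < k ] ∑[ j < k ] 𝟙 (P? i j))
Fin²-cardinality {k = k} P P? =
  ↔-trans (Fin-∑↔Σ (λ i → ∑[ j < k ] 𝟙 (P? i j))) (Σ-cong ↔-refl (λ {i} → Fin-∑↔Σ (λ j → 𝟙 (P? i j)))) ∙ᵢ
  bijective⇒inverse (≡.setoid Marked) (subsetoid (Fin² k) P)
    (λ (i , j , x) → (i , j) , holds (P? i j) x)
    (λ { refl → refl , refl })
    (λ { {i , j , x} {_ , _ , y} (refl , refl) → cong (λ u → i , j , u) (unique (P? i j) x y) })
    (λ ((i , j) , Pij) → (i , j , mark (P? i j) Pij) , refl , refl)
  where
  Marked : Set
  Marked = Σ (Fin k) λ i → Σ (Fin k) λ j → Fin (𝟙 (P? i j))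
  holds : {A : Set p} (A? : Dec A) → Fin (𝟙 A?) → A
  holds (yes x) _ = x
  unique : {A : Set p} (A? : Dec A) (x y : Fin (𝟙 A?)) → x ≡ y
  unique (yes _) zero zero = refl
  mark : {A : Set p} (A? : Dec A) → A → Fin (𝟙 A?)
  mark (yes _) _ = zero
  mark (no ¬x) x = contradiction x ¬x

cardinality-unique : (S : Setoid a ℓ₁) {m n : ℕ} → HasCardinality S m → HasCardinality S n → m ≡ n
cardinality-unique S m-elements n-elements = ↔⇒≡ (m-elements ∙ᵢ symᵢ n-elements)

-- Difference sets

module _ {c ℓ : Level} (G : Group c ℓ) where

  open Group G renaming (_∙_ to _⊕_; ε to 0#; _//_ to _⊖_; refl to ≈-refl; sym to ≈-sym; trans to ≈-trans)
    hiding (_-_; inverse)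
  open GroupProperties G
  open GroupMorphisms rawGroup rawGroup using (IsGroupIsomorphism)

  G² : Setoid _ _
  G² = ×-setoid setoid setoid

  x≈y//z⇒x∙z≈y : ∀ {x y z} → x ≈ y ⊖ z → x ⊕ z ≈ y
  x≈y//z⇒x∙z≈y {x} {y} {z} eq = ≈-trans (∙-congʳ eq) (//-rightDividesˡ z y)

  y≈x\\z⇒x∙y≈z : ∀ {x y z} → y ≈ x \\ z → x ⊕ y ≈ z
  y≈x\\z⇒x∙y≈z {x} {y} {z} eq = ≈-trans (∙-congˡ eq) (\\-leftDividesˡ x z)

  \\-//-exchange : ∀ {w x y z} → w \\ x ≈ y \\ z ⇔ y ⊖ w ≈ z ⊖ x
  \\-//-exchange {w} {x} {y} {z} = mk⇔
    -- Both equations are rearrangements of `(y ⊖ w) ⊕ x ≈ z`.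
    (λ eq → x≈z//y _ _ _ (begin
      (y ⊖ w) ⊕ x     ≈⟨ assoc y (w ⁻¹) x ⟩
      y ⊕ (w \\ x)    ≈⟨ y≈x\\z⇒x∙y≈z eq ⟩
      z               ∎))
    (λ eq → y≈x\\z _ _ _ (begin
      y ⊕ (w \\ x)    ≈⟨ assoc y (w ⁻¹) x ⟨
      (y ⊖ w) ⊕ x     ≈⟨ x≈y//z⇒x∙z≈y eq ⟩
      z               ∎))
    where open SetoidReasoning setoid

  -- An antiautomorphism `φ` sends `- b + a`, not `a - b`, to `φ a - φ b`; these are therefore the
  -- representations to count when `D` is mapped by one.
  LeftRepresentations : ∀ {p} → Pred Carrier p → Carrier → Pred (Carrier × Carrier) (ℓ ⊔ p)
  LeftRepresentations D g (a , b) = a ∈ D × b ∈ D × g ≈ b \\ a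

  module _ {p} {v k λ′ : ℕ} {D : Pred Carrier p} (isDS : IsDifferenceSet G v k λ′ D) where

    open IsDifferenceSet isDS
    open IsSubsetOfSize isSubset
    private
      module O = Inverse order
      module C = Inverse cardinality

      d : Fin k → Carrier
      d = proj₁ ∘ C.to

      index : Carrier → Fin v
      index = O.from

      element-index : ∀ g → O.to (index g) ≈ g
      element-index = O.strictlyInverseˡ

      index-injective : ∀ {g h} → index g ≡ index h → g ≈ h
      index-injective {g} {h} eq =
        ≈-trans (≈-sym (element-index g)) (≈-trans (O.to-cong eq) (element-index h))

      index-⇔ : ∀ {g h g′ h′} → g ≈ h ⇔ g′ ≈ h′ → index g ≡ index h ⇔ index g′ ≡ index h′
      index-⇔ eq = mk⇔ (O.from-cong ∘ Equivalence.to eq ∘ index-injective)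
                       (O.from-cong ∘ Equivalence.from eq ∘ index-injective)

      -- The enumeration `d` of `D` replaces pairs of elements by pairs of indices. The operation is
      -- kept abstract so that one count covers both `a - b` and `- b + a`.
      pairs-cardinality : (_⊙_ : Carrier → Carrier → Carrier) →
        (∀ {w x y z} → w ≈ x → y ≈ z → (w ⊙ y) ≈ (x ⊙ z)) → ∀ g →
        HasCardinality (subsetoid G² (λ (a , b) → a ∈ D × b ∈ D × g ≈ (a ⊙ b)))
          (multiplicity (λ i j → index (d i ⊙ d j)) (index g))
      pairs-cardinality _⊙_ ⊙-cong g =
        Fin²-cardinality (λ (i , j) → index (d i ⊙ d j) ≡ index g) (λ i j → index (d i ⊙ d j) ≟ index g) ∙ᵢ
        subsetoid-inverse (Fin² k) G² _ _ (λ (i , j) → d i , d j)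
          (λ { (refl , refl) → ≈-refl , ≈-refl })
          (λ (eq₁ , eq₂) → d-injective eq₁ , d-injective eq₂)
          (λ {(i , j)} eq → proj₂ (C.to i) , proj₂ (C.to j) , ≈-sym (index-injective eq))
          (λ {(a , b)} (a∈D , b∈D , eq) →
            let a≈ = C.strictlyInverseˡ (a , a∈D)
                b≈ = C.strictlyInverseˡ (b , b∈D)
            in (C.from (a , a∈D) , C.from (b , b∈D)) ,
               O.from-cong (≈-trans (⊙-cong a≈ b≈) (≈-sym eq)) ,
               a≈ , b≈)
        where
        d-injective : ∀ {i j} → d i ≈ d j → i ≡ j
        d-injective {i} {j} eq =
          ≡.trans (≡.sym (C.strictlyInverseʳ i)) (≡.trans (C.from-cong eq) (C.strictlyInverseʳ j))

      right left : Fin k → Fin k → Fin v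
      right i j = index (d i ⊖ d j)
      left  i j = index (d j \\ d i)

      right-multiplicity : ∀ t → t ≢ index 0# → multiplicity right t ≡ λ′
      right-multiplicity t t≢0 = ≡.trans (cong (multiplicity right) (≡.sym (O.strictlyInverseʳ t)))
        (cardinality-unique _ (pairs-cardinality _⊖_ //-cong₂ (O.to t))
          (representations (O.to t)
            (λ t≈0 → t≢0 (≡.trans (≡.sym (O.strictlyInverseʳ t)) (O.from-cong t≈0)))))

      left-multiplicity : ∀ t → t ≢ index 0# → multiplicity left t ≡ λ′
      left-multiplicity t t≢0 = ≡.trans
        (multiplicity-unique right left (index 0#) λ′
          -- The identity behind the equal second moments: `- d m + d l = - d j + d i` exactly when
          -- `d j - d m = d i - d l`.
          (λ i j l m → index-⇔ \\-//-exchange)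
          -- Either kind of difference is 0 exactly when `d i ≈ d j`.
          (λ i j → index-⇔ (mk⇔
            (λ eq → x≈y⇒x∙y⁻¹≈ε (≈-trans (≈-sym (y≈x\\z⇒x∙y≈z (≈-sym eq))) (identityʳ (d j))))
            (λ eq → ≈-trans (∙-congˡ (x∙y⁻¹≈ε⇒x≈y (d i) (d j) eq)) (inverseˡ (d j)))))
          right-multiplicity t)
        (right-multiplicity t t≢0)

    leftRepresentations : ∀ g → ¬ g ≈ 0# →
      HasCardinality (subsetoid G² (LeftRepresentations D g)) λ′
    leftRepresentations g g≉0 =
      ≡.subst (HasCardinality _) (left-multiplicity (index g) (g≉0 ∘ index-injective))
        (pairs-cardinality (λ a b → b \\ a) (λ eq₁ eq₂ → \\-cong₂ eq₂ eq₁) g)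

  -- Automorphisms and antiautomorphisms treated together

  record IsSemiAutomorphism (φ : Carrier → Carrier) : Set (c ⊔ ℓ) where
    field
      φ-cong    : Congruent _≈_ _≈_ φ
      bijective : Bijective _≈_ _≈_ φ
      homo⊎anti : (∀ g h → φ (g ⊕ h) ≈ φ g ⊕ φ h) ⊎ (∀ g h → φ (g ⊕ h) ≈ φ h ⊕ φ g)

    injective : Injective _≈_ _≈_ φ
    injective = proj₁ bijective

    inverse : Carrier → Carrier
    inverse = proj₁ ∘ proj₂ bijective

    φ-inverse : ∀ g → φ (inverse g) ≈ g
    φ-inverse g = proj₂ (proj₂ bijective g) ≈-refl

    φ-0# : φ 0# ≈ 0#
    φ-0# = identityˡ-unique (φ 0#) (φ 0#)
      (≈-trans (≈-sym ([ (λ homo → homo 0# 0#) , (λ anti → anti 0# 0#) ]′ homo⊎anti)) (φ-cong (identityˡ 0#)))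

  open IsSemiAutomorphism

  autoOrAntiauto⇒semi : ∀ {φ} → IsAutoOrAntiauto G φ → IsSemiAutomorphism φ
  autoOrAntiauto⇒semi (inj₁ auto) = record
    { φ-cong = A.⟦⟧-cong ; bijective = A.injective , A.surjective ; homo⊎anti = inj₁ A.∙-homo }
    where module A = IsGroupIsomorphism auto
  autoOrAntiauto⇒semi (inj₂ anti) = record
    { φ-cong = A.cong ; bijective = A.bijective ; homo⊎anti = inj₂ A.anti-homo }
    where module A = IsAntiautomorphism anti

  inverse-semi : ∀ {φ} (s : IsSemiAutomorphism φ) → IsSemiAutomorphism (inverse s)
  inverse-semi {φ} s = record
    { φ-cong    = λ eq → injective s (≈-trans (φ-inverse s _) (≈-trans eq (≈-sym (φ-inverse s _))))
    ; bijective = sym-bijective (bijective s) ≈-refl ≈-sym ≈-trans (φ-cong s)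
    ; homo⊎anti = [ (λ homo → inj₁ λ g h → injective s (≈-trans (φ-inverse s _) (≈-sym
                      (≈-trans (homo _ _) (∙-cong (φ-inverse s g) (φ-inverse s h))))))
                  , (λ anti → inj₂ λ g h → injective s (≈-trans (φ-inverse s _) (≈-sym
                      (≈-trans (anti _ _) (∙-cong (φ-inverse s g) (φ-inverse s h))))))
                  ]′ (homo⊎anti s)
    }

  -- Negation is an antiautomorphism, so composing with it exchanges the two kinds. This handles the
  -- differences whose first coordinate is the constant 0.
  0-semi : ∀ {φ} → IsSemiAutomorphism φ → IsSemiAutomorphism (λ g → 0# ⊖ φ g)
  0-semi {φ} s = record
    { φ-cong    = λ eq → //-cong₂ ≈-refl (φ-cong s eq)
    ; bijective = (λ eq → injective s (⁻¹-injective (∙-cancelˡ 0# _ _ eq))) ,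
                  (λ g → inverse s (g ⁻¹) , λ eq →
                    ≈-trans (identityˡ _) (≈-trans
                      (⁻¹-cong (≈-trans (φ-cong s eq) (φ-inverse s (g ⁻¹)))) (⁻¹-involutive g)))
    ; homo⊎anti = [ (λ homo → inj₂ λ g h → reverse (homo g h)) , (λ anti → inj₁ λ g h → reverse (anti g h)) ]′
                    (homo⊎anti s)
    }
    where
    reverse : ∀ {x y z} → x ≈ y ⊕ z → 0# ⊖ x ≈ (0# ⊖ z) ⊕ (0# ⊖ y)
    reverse {x} {y} {z} eq = ≈-trans (identityˡ _) (≈-trans (⁻¹-cong eq) (≈-trans (⁻¹-anti-homo-∙ y z)
      (≈-sym (∙-cong (identityˡ (z ⁻¹)) (identityˡ (y ⁻¹))))))

  -- Images of difference sets

  module _ {p q} {v k λ′ : ℕ} {D : Pred Carrier p} {D₁ : Pred Carrier q} {φ : Carrier → Carrier}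
    (s : IsSemiAutomorphism φ) (D₁-respects : D₁ Respects _≈_)
    (to-image : ∀ {g} → g ∈ D → φ g ∈ D₁) (from-image : ∀ {h} → h ∈ D₁ → ∃[ g ] g ∈ D × φ g ≈ h)
    (isDS : IsDifferenceSet G v k λ′ D) where

    open IsDifferenceSet isDS

    private
      -- Representations of `g` in `D₁` are pulled back along `φ` to pairs of `D` that yield `h`,
      -- the preimage of `g`. The operation is `a - b` for an automorphism and `- b + a` for an
      -- antiautomorphism.
      image-representations : ∀ g (_⊙_ : Carrier → Carrier → Carrier) →
        (∀ {h a b} → φ h ≈ g → h ≈ (a ⊙ b) ⇔ g ≈ φ a ⊖ φ b) →
        (∀ h → ¬ h ≈ 0# → HasCardinality (subsetoid G² (λ (a , b) → a ∈ D × b ∈ D × h ≈ (a ⊙ b))) λ′) →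
        ¬ g ≈ 0# → HasCardinality (subsetoid G² (Representations G D₁ g)) λ′
      image-representations g _⊙_ equiv reps g≉0 =
        -- `h` is nonzero because `φ` fixes 0 and `g` is nonzero.
        reps h (λ h≈0 → g≉0 (≈-trans (≈-sym φh≈g) (≈-trans (φ-cong s h≈0) (φ-0# s)))) ∙ᵢ
        subsetoid-inverse G² G² _ _ (λ (a , b) → φ a , φ b)
          (λ (eq₁ , eq₂) → φ-cong s eq₁ , φ-cong s eq₂)
          (λ (eq₁ , eq₂) → injective s eq₁ , injective s eq₂)
          (λ (a∈D , b∈D , eq) → to-image a∈D , to-image b∈D , Equivalence.to (equiv φh≈g) eq)
          (λ (a∈D₁ , b∈D₁ , eq) →
            let a , a∈D , φa≈ = from-image a∈D₁
                b , b∈D , φb≈ = from-image b∈D₁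
            in (a , b) ,
               (a∈D , b∈D , Equivalence.from (equiv φh≈g) (≈-trans eq (≈-sym (//-cong₂ φa≈ φb≈)))) ,
               φa≈ , φb≈)
        where
        h = inverse s g
        φh≈g = φ-inverse s g

    -- `D₁` is any predicate with the elements of the image, which lets both a preimage under `φ₁`
    -- and a set `Differences E x y` take its place.
    image-isDifferenceSet : IsDifferenceSet G v k λ′ D₁
    image-isDifferenceSet = record
      { order           = order
      ; isSubset        = record
        { respects    = D₁-respects
        ; cardinality = IsSubsetOfSize.cardinality isSubset ∙ᵢ
            subsetoid-inverse setoid setoid D D₁ φ (φ-cong s) (injective s) to-image from-image
        }
      ; representations = λ g → [ homo-case g , anti-case g ]′ (homo⊎anti s)
      }
      where
      homo-case : ∀ g → (∀ x y → φ (x ⊕ y) ≈ φ x ⊕ φ y) → ¬ g ≈ 0# →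
        HasCardinality (subsetoid G² (Representations G D₁ g)) λ′
      homo-case g homo = image-representations g _⊖_
        (λ φh≈g → mk⇔
          (λ eq → x≈z//y _ _ _ (≈-trans (∙-congʳ (≈-sym φh≈g))
                    (≈-trans (≈-sym (homo _ _)) (φ-cong s (x≈y//z⇒x∙z≈y eq)))))
          (λ eq → x≈z//y _ _ _ (injective s (≈-trans (homo _ _)
                    (≈-trans (∙-congʳ φh≈g) (x≈y//z⇒x∙z≈y eq))))))
        representations
      anti-case : ∀ g → (∀ x y → φ (x ⊕ y) ≈ φ y ⊕ φ x) → ¬ g ≈ 0# →
        HasCardinality (subsetoid G² (Representations G D₁ g)) λ′
      anti-case g anti = image-representations g (λ a b → b \\ a)
        -- `h = - b + a` means `b + h = a`. Applying `φ` reverses this to `g + φ b = φ a`, that is,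
        -- `g = φ a - φ b`.
        (λ φh≈g → mk⇔
          (λ eq → x≈z//y _ _ _ (≈-trans (∙-congʳ (≈-sym φh≈g))
                    (≈-trans (≈-sym (anti _ _)) (φ-cong s (y≈x\\z⇒x∙y≈z eq)))))
          (λ eq → y≈x\\z _ _ _ (injective s (≈-trans (anti _ _)
                    (≈-trans (∙-congʳ φh≈g) (x≈y//z⇒x∙z≈y eq))))))
        (leftRepresentations isDS)

  -- The extension built from a regular set

  module _ {p} {m v k λ′ : ℕ} {D : Pred Carrier p} (isDS : IsDifferenceSet G v k λ′ D)
    {φ : Fin (suc m) → Carrier → Carrier} (regular : IsRegularSet G φ) where

    private
      module R = IsRegularSet regular
      V = ≋-setoid setoid (suc (suc m))

      tuple : Carrier → Vector.Vector Carrier (suc (suc m))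
      tuple g = 0# Vector.∷ λ x → φ x g

      member : ∀ x → IsSemiAutomorphism (φ x)
      member x = autoOrAntiauto⇒semi (R.members x)

      φ₁ = φ zero
      φ₁-semi = member zero

      -- The image of `D` under the inverse of `φ₁`, written as a preimage. Starting from it instead
      -- of `D` makes the difference of `φ₁ g` and 0 range over `D` itself.
      D₁ : Pred Carrier p
      D₁ g = φ₁ g ∈ D

      D-respects : D Respects _≈_
      D-respects = IsSubsetOfSize.respects (IsDifferenceSet.isSubset isDS)

      D₁-isDifferenceSet : IsDifferenceSet G v k λ′ D₁
      D₁-isDifferenceSet = image-isDifferenceSet (inverse-semi φ₁-semi)
        (λ eq → D-respects (φ-cong φ₁-semi eq))
        (D-respects (≈-sym (φ-inverse φ₁-semi _)))
        (λ {h} φ₁h∈D → φ₁ h , φ₁h∈D , injective φ₁-semi (φ-inverse φ₁-semi (φ₁ h)))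
        isDS

      -- Membership is up to pointwise equality, so that `E` respects the equality of vectors.
      E : Pred (Vector.Vector Carrier (suc (suc m))) (c ⊔ ℓ ⊔ p)
      E e = ∃[ g ] g ∈ D₁ × Setoid._≈_ V (tuple g) e

      tuple-cong : Congruent _≈_ (Setoid._≈_ V) tuple
      tuple-cong eq zero    = ≈-refl
      tuple-cong eq (suc x) = φ-cong (member x) eq

      differences-semi : ∀ x y → x Fin.< y → IsSemiAutomorphism (λ g → tuple g x ⊖ tuple g y)
      differences-semi zero    (suc y) _         = 0-semi (member y)
      differences-semi (suc x) (suc y) (s≤s x<y) = autoOrAntiauto⇒semi (R.differences x y x<y)

    extends : ExtendsToDimension G (suc (suc m)) v k λ′ D
    extends = E ,
      record
        { order       = IsDifferenceSet.order isDS
        ; isSubset    = record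
          { respects    = λ e≈e′ (g , g∈D₁ , eq) → g , g∈D₁ , Setoid.trans V eq e≈e′
          ; cardinality = IsSubsetOfSize.cardinality (IsDifferenceSet.isSubset D₁-isDifferenceSet) ∙ᵢ
              subsetoid-inverse setoid V D₁ E tuple tuple-cong
                -- The coordinate `φ₁ g` already determines `g`, so distinct elements of `D₁` give
                -- distinct tuples.
                (λ eq → injective φ₁-semi (eq (suc zero)))
                (λ g∈D₁ → _ , g∈D₁ , Setoid.refl V)
                (λ e∈E → e∈E)
          }
        ; differences = λ x y x<y → image-isDifferenceSet (differences-semi x y x<y)
            (λ g≈h (e , e∈E , eq) → e , e∈E , ≈-trans (≈-sym g≈h) eq)
            (λ {g} g∈D₁ → tuple g , (g , g∈D₁ , Setoid.refl V) , ≈-refl)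
            (λ (e , (g , g∈D₁ , eq′) , eq) → g , g∈D₁ , ≈-trans (//-cong₂ (eq′ x) (eq′ y)) (≈-sym eq))
            D₁-isDifferenceSet
        } ,
      -- The order matters: `φ₁ g - 0` recovers `D`, while the opposite order would give the
      -- negatives of its elements.
      suc zero , zero , (λ ()) ,
      (λ {g} g∈D → let h = inverse φ₁-semi g ; φh≈g = φ-inverse φ₁-semi g in
        tuple h , (h , D-respects (≈-sym φh≈g) g∈D , Setoid.refl V) ,
        ≈-trans (≈-sym φh≈g) (≈-sym (x⊖0≈x (φ₁ h)))) ,
      (λ (e , (h , φ₁h∈D , eq′) , eq) → D-respects
        (≈-sym (≈-trans eq (≈-trans (//-cong₂ (≈-sym (eq′ (suc zero))) (≈-sym (eq′ zero))) (x⊖0≈x (φ₁ h))))) φ₁h∈D)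
      where
      x⊖0≈x : ∀ x → x ⊖ 0# ≈ x
      x⊖0≈x x = ≈-trans (∙-congˡ ε⁻¹≈ε) (identityʳ x)

theorem4p7 : ∀ {c ℓ p} (G : Group c ℓ) (v n : ℕ) →
    HasCardinality (Group.setoid G) v → 2 ≤ n →
    AllowsRegularSetOfSize G (n ∸ 1) →
    ∀ (k λ′ : ℕ) (D : Pred (Group.Carrier G) p) →
    IsDifferenceSet G v k λ′ D →
    ExtendsToDimension G n v k λ′ D
-- For `n = m + 2` the regular set has `m + 1` members, so a first member `φ₁` exists.
theorem4p7 G v (suc (suc m)) _ _ (φ , regular) k λ′ D isDS = extends G isDS regular
theorem4p7 G v (suc zero) _ (s≤s ())
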